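{- Fix $k\ge 1$ and any family $\mathcal{F}\subseteq 2^{[k]}\setminus\{\emptyset\}$. For Slot-Heterogenous Paging with $k$ slots and requestable slot sets from $\mathcal{F}$, the online algorithm ExhSearch (described in the context) has competitive ratio at most $k\cdot\min\{|\mathcal{F}^\ast|,\ \mathrm{mass}(\mathcal{F})\}$, where $\mathcal{F}^\ast=\bigcup_{S\in\mathcal{F}}2^{S}$ and $\mathrm{mass}(\mathcal{F})=\sum_{S\in\mathcal{F}}|S|$.
   Context: Slot-Heterogenous Paging: there are cache slots $[k]=\{1,\dots,k\}$ and a family $\mathcal{F}\subseteq 2^{[k]}\setminus\{\emptyset\}$ of requestable slot sets. A request sequence is $\sigma=(\sigma_1,\dots,\sigma_T)$ with $\sigma_t=(p_t,S_t)$, $p_t$ a page and $S_t\in\mathcal{F}$. A cache configuration assigns to each slot either a single page or nothing; it satisfies a request $(p,S)$ if it assigns $p$ to at least one slot in $S$. A solution is a sequence of configurations $C_1,\dots,C_T$ with $C_t$ satisfying $\sigma_t$ for every $t$. Its cost is the number of retrievals, where page $p$ is retrieved in slot $s$ at time $t$ if $C_t$ assigns $p$ to $s$ but $C_{t-1}$ does not (or $t=1$). $\mathrm{OPT}(\sigma)$ is the minimum cost. An online algorithm (choosing $C_t$ knowing only $\sigma_1,\dots,\sigma_t$) is $c$-competitive if there is a constant $b$ independent of $\sigma$ with $\mathrm{cost}(\sigma)\le c\cdot\mathrm{OPT}(\sigma)+b$ for all $\sigma$. Algorithm ExhSearch: let the initial configuration $C_0$ be arbitrary and set $\ell\gets 1$.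 For $t=1,\dots,T$: if $C_{t-1}$ satisfies $\sigma_t$, set $C_t=C_{t-1}$; otherwise, if some configuration satisfies all requests $\sigma_\ell,\sigma_{\ell+1},\dots,\sigma_t$, let $C_t$ be any such configuration; otherwise set $\ell\gets t$ and let $C_t$ be any configuration satisfying $\sigma_t$. -}

module Defs where

open import Data.Nat using (ℕ; zero; suc; _+_; _*_; _⊓_; _≡ᵇ_)
open import Data.Bool using (if_then_else_)
open import Data.Fin using (Fin)
open import Data.Fin.Subset as Sub using (Subset; inside; outside; ∣_∣; _⊆_)
open import Data.Fin.Subset.Properties using (_⊆?_)
open import Data.Maybe using (Maybe; just; nothing)
open import Data.List using (List; []; _∷_; _++_; [_]; map; length; filter; allFin)
open import Data.Nat.ListAction using (sum)
open import Data.List.Relation.Unary.All using (All)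
open import Data.List.Relation.Unary.Any using (any?)
open import Data.List.Membership.Propositional using (_∈_)
open import Data.Vec using (Vec; []; _∷_)
open import Data.Product using (Σ; _×_; _,_; ∃)
open import Relation.Binary.PropositionalEquality using (_≡_)
open import Relation.Nullary using (¬_)

Page : Set
Page = ℕ

Config : ℕ → Set
Config k = Fin k → Maybe Page

-- The empty configuration (used as the "previous" configuration at t = 1,
-- so that every page held at time 1 counts as a retrieval).
emptyConfig : ∀ {k} → Config k
emptyConfig _ = nothing

Request : ℕ → Set
Request k = Page × Subset k

Satisfies : ∀ {k} → Config k → Request k → Set
Satisfies {k} C (p , S) = Σ (Fin k) λ s → s Sub.∈ S × C s ≡ just p

SatisfiesAll : ∀ {k} → Config k → List (Request k) → Set
SatisfiesAll C rs = All (Satisfies C) rs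

retrievedIn : Maybe Page → Maybe Page → ℕ
retrievedIn _        nothing  = 0
retrievedIn nothing  (just p) = 1
retrievedIn (just q) (just p) = if q ≡ᵇ p then 0 else 1

retrievals : ∀ {k} → Config k → Config k → ℕ
retrievals {k} prev C = sum (map (λ s → retrievedIn (prev s) (C s)) (allFin k))

costFrom : ∀ {k} → Config k → List (Config k) → ℕ
costFrom prev []       = 0
costFrom prev (C ∷ Cs) = retrievals prev C + costFrom C Cs

cost : ∀ {k} → List (Config k) → ℕ
cost Cs = costFrom emptyConfig Cs

data IsSolution {k : ℕ} : List (Request k) → List (Config k) → Set where
  []  : IsSolution [] []
  _∷_ : ∀ {r rs C Cs} → Satisfies C r → IsSolution rs Cs → IsSolution (r ∷ rs) (C ∷ Cs)

-- One step of ExhSearch.  `w` is the current window σ_ℓ … σ_{t-1},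
-- `C` is C_{t-1}, `r` is σ_t; the step produces the new window
-- σ_ℓ' … σ_t and the configuration C_t.
data ExhStep {k : ℕ} (w : List (Request k)) (C : Config k) (r : Request k)
     : List (Request k) → Config k → Set where
  keep    : Satisfies C r → ExhStep w C r (w ++ [ r ]) C
  extend  : ∀ {C'} → ¬ Satisfies C r → SatisfiesAll C' (w ++ [ r ])
          → ExhStep w C r (w ++ [ r ]) C'
  restart : ∀ {C'} → ¬ Satisfies C r
          → ¬ (∃ λ (D : Config k) → SatisfiesAll D (w ++ [ r ]))
          → Satisfies C' r
          → ExhStep w C r [ r ] C'

data ExhRun {k : ℕ} : List (Request k) → Config k → List (Request k) → List (Config k) → Set where
  []  : ∀ {w C} → ExhRun w C [] []
  _∷_ : ∀ {w C r rs w' C' Cs} → ExhStep w C r w' C' → ExhRun w' C' rs Cs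
      → ExhRun w C (r ∷ rs) (C' ∷ Cs)

-- Cs is a possible output of ExhSearch on σ started from initial
-- configuration C₀ (ℓ = 1, i.e. the window is initially empty).
ExhSearchRun : ∀ {k} → Config k → List (Request k) → List (Config k) → Set
ExhSearchRun C₀ σ Cs = ExhRun [] C₀ σ Cs

allSubsets : (k : ℕ) → List (Subset k)
allSubsets zero    = [ [] ]
allSubsets (suc k) = map (outside ∷_) (allSubsets k) ++ map (inside ∷_) (allSubsets k)

starSize : ∀ {k} → List (Subset k) → ℕ
starSize {k} F = length (filter (λ T → any? (λ S → T ⊆? S) F) (allSubsets k))

mass : ∀ {k} → List (Subset k) → ℕ
mass F = sum (map ∣_∣ F)

{-# OPTIONS --safe #-}

-- Call a step of ExhSearch costly if the current configuration violates the
-- request; it retrieves at most k pages, and every other step none. A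
-- phase is a maximal run of steps without an intervening restart. Any solution
-- retrieves a page between two consecutive restarts, for otherwise its configuration
-- at the first one would satisfy the whole window and the request
-- that triggers the second one. It remains to bound the costly steps of a phase.
--
-- Let (p₁ , S₁), (p₂ , S₂), … be the requests at the costly steps of one phase
-- and C₁, C₂, … the configurations just before them: Cᵢ violates the i-th request
-- and satisfies the earlier ones. The requests are thus distinct, and as a single
-- configuration satisfies them all, each is determined by its set S and a slot of S
-- holding its page; this gives the bound mass F. Encoding slot contents as integers
-- c_s, the polynomials fᵢ(c) = ∏_{s ∈ Sᵢ} (pᵢ − c_s) satisfy fᵢ(Cᵢ) ≠ 0 and
-- fⱼ(Cᵢ) = 0 for j < i, so they are linearly independent; they lie in the span of
-- the monomials ∏_{s ∈ T} c_s with T ∈ F*, which gives the bound |F*|.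

module Submission where

open import Defs
open import Data.Bool using (true; false)
open import Data.Empty using (⊥-elim)
open import Data.Fin using (Fin; zero; suc)
open import Data.Fin.Properties using (injective⇒≤)
open import Data.Fin.Subset as Sub using (Subset; Nonempty; inside; outside; ∣_∣)
open import Data.Fin.Subset.Properties using (_⊆?_; out⊆; in⊆in)
open import Data.Integer as ℤ using (ℤ; 0ℤ; 1ℤ; -1ℤ)
import Data.Integer.Properties as ℤ
open import Data.Integer.Tactic.RingSolver using (solve-∀)
open import Data.List using (List; []; _∷_; _++_; [_]; map; length; filter; allFin; lookup)
open import Data.List.Membership.Propositional using (_∈_; lose)
open import Data.List.Membership.Propositional.Properties using (∈-map⁺; ∈-++⁺ˡ; ∈-++⁺ʳ; ∈-lookup; ∈-allFin)
import Data.List.Membership.Setoid.Properties as Membership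
open import Data.List.Properties using (length-map; length-++; length-tabulate)
open import Data.List.Relation.Unary.All as All using (All; []; _∷_)
import Data.List.Relation.Unary.All.Properties as All
open import Data.List.Relation.Unary.AllPairs using (AllPairs; []; _∷_)
open import Data.List.Relation.Unary.Any using (here; there; any?; index)
open import Data.List.Relation.Unary.Unique.Propositional using (Unique)
open import Data.Maybe using (Maybe; just; nothing)
open import Data.Maybe.Properties using (just-injective)
open import Data.Nat using (ℕ; zero; suc; _≤_; z≤n; s≤s; _+_; _*_; _⊓_; _≡ᵇ_)
open import Data.Nat.ListAction using (sum)
open import Data.Nat.Properties as ℕ using (≡ᵇ⇒≡; ≡⇒≡ᵇ; suc-injective)
import Data.Nat.Tactic.RingSolver as ℕ-Solver
open import Data.Product using (∃; _×_; _,_; proj₁; proj₂)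
open import Data.Sum using (inj₁; inj₂; [_,_]′)
open import Data.Vec using ([]; _∷_; here; there)
open import Function using (_∘_)
open import Relation.Binary.PropositionalEquality using (_≡_; _≢_; refl; sym; trans; cong; cong₂; subst; setoid; module ≡-Reasoning)
open import Relation.Nullary using (¬_; yes; no; contradiction)
open import Relation.Unary using (Decidable)

-- `Q` supplies facts about single elements, such as membership of a set in `F`, on which passing
-- from `R` to `R′` may depend.
AllPairs-map⁺ : ∀ {A B : Set} {Q : A → Set} {R : A → A → Set} {R′ : B → B → Set} {f : A → B} →
  (∀ {x y} → Q x → Q y → R x y → R′ (f x) (f y)) →
  ∀ {xs} → All Q xs → AllPairs R xs → AllPairs R′ (map f xs)
AllPairs-map⁺ h []       []       = []
AllPairs-map⁺ h (p ∷ qs) (r ∷ rs) =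
  All.map⁺ (All.map (λ (q , r) → h p q r) (All.zip (qs , r))) ∷ AllPairs-map⁺ h qs rs

-- Linear independence of triangular systems

dot : {I : Set} → List I → (I → ℤ) → (I → ℤ) → ℤ
dot []      u w = 0ℤ
dot (i ∷ L) u w = u i ℤ.* w i ℤ.+ dot L u w

module _ {I : Set} where

  dot-++ : ∀ (L M : List I) u w → dot (L ++ M) u w ≡ dot L u w ℤ.+ dot M u w
  dot-++ []      M u w = sym (ℤ.+-identityˡ _)
  dot-++ (i ∷ L) M u w = trans (cong (ℤ._+_ (u i ℤ.* w i)) (dot-++ L M u w)) (sym (ℤ.+-assoc (u i ℤ.* w i) (dot L u w) (dot M u w)))

  dot-combine : ∀ (L : List I) u w v a b →
    dot L u (λ i → a ℤ.* w i ℤ.- b ℤ.* v i) ≡ a ℤ.* dot L u w ℤ.- b ℤ.* dot L u v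
  dot-combine []      u w v a b = zeros a b
    where
    zeros : ∀ a b → 0ℤ ≡ a ℤ.* 0ℤ ℤ.- b ℤ.* 0ℤ
    zeros = solve-∀
  dot-combine (i ∷ L) u w v a b =
    trans (cong (ℤ._+_ (u i ℤ.* (a ℤ.* w i ℤ.- b ℤ.* v i))) (dot-combine L u w v a b))
          (regroup a b (u i) (w i) (v i) (dot L u w) (dot L u v))
    where
    regroup : ∀ a b x y z p q →
      x ℤ.* (a ℤ.* y ℤ.- b ℤ.* z) ℤ.+ (a ℤ.* p ℤ.- b ℤ.* q)
        ≡ a ℤ.* (x ℤ.* y ℤ.+ p) ℤ.- b ℤ.* (x ℤ.* z ℤ.+ q)
    regroup = solve-∀

  dot-filter : ∀ {P : I → Set} (P? : Decidable P) u w → (∀ i → ¬ P i → u i ≡ 0ℤ) →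
    ∀ L → dot (filter P? L) u w ≡ dot L u w
  dot-filter P? u w u≡0 []      = refl
  dot-filter P? u w u≡0 (i ∷ L) with P? i
  ... | yes _  = cong (ℤ._+_ (u i ℤ.* w i)) (dot-filter P? u w u≡0 L)
  ... | no ¬Pi rewrite u≡0 i ¬Pi = trans (dot-filter P? u w u≡0 L) (sym (ℤ.+-identityˡ _))

  -- A nonzero product has a nonzero summand, whose index becomes the pivot. Its removal from `L` is
  -- recorded only through the effect on `dot`, which is all that elimination uses.
  dot-split : ∀ (L : List I) u w → dot L u w ≢ 0ℤ →
    ∃ λ e → ∃ λ L′ → w e ≢ 0ℤ × length L ≡ suc (length L′) ×
      (∀ x y → dot L x y ≡ x e ℤ.* y e ℤ.+ dot L′ x y)
  dot-split []      u w ≢0 = contradiction refl ≢0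
  dot-split (i ∷ L) u w ≢0 with w i ℤ.≟ 0ℤ
  ... | no wi≢0  = i , L , wi≢0 , refl , λ _ _ → refl
  ... | yes wi≡0 =
    let e , L′ , we≢0 , len , split = dot-split L u w (≢0 ∘ head-vanishes)
    in e , i ∷ L′ , we≢0 , cong suc len ,
       λ x y → trans (cong (ℤ._+_ (x i ℤ.* y i)) (split x y)) (swap (x i ℤ.* y i) (x e ℤ.* y e) (dot L′ x y))
    where
    head-vanishes : dot L u w ≡ 0ℤ → dot (i ∷ L) u w ≡ 0ℤ
    head-vanishes eq rewrite wi≡0 | ℤ.*-zeroʳ (u i) | eq = refl
    swap : ∀ a b c → a ℤ.+ (b ℤ.+ c) ≡ b ℤ.+ (a ℤ.+ c)
    swap = solve-∀

  Vectors : Set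
  Vectors = (I → ℤ) × (I → ℤ)

  Nonsingular : List I → Vectors → Set
  Nonsingular L (u , w) = dot L u w ≢ 0ℤ

  Orthogonal : List I → Vectors → Vectors → Set
  Orthogonal L (_ , w) (u′ , _) = dot L u′ w ≡ 0ℤ

  -- Induction on the dimension: the first w of the list is orthogonal to all later
  -- u, so subtracting multiples of it from the later w changes no product, and
  -- makes a coordinate where it is nonzero vanish in them.
  triangular-length : ∀ n (L : List I) → length L ≡ n → ∀ P →
    All (Nonsingular L) P → AllPairs (Orthogonal L) P → length P ≤ n
  triangular-length n       L  len []            _            _             = z≤n
  triangular-length zero    [] len (_ ∷ _)       (ns ∷ _)     _             = contradiction refl ns
  triangular-length (suc n) L  len ((u , w) ∷ P) (ns ∷ nss)   (orth ∷ orths)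
    with dot-split L u w ns
  ... | e , L′ , we≢0 , len′ , split =
    s≤s (subst (_≤ n) (length-map reduce P)
      (triangular-length n L′ (suc-injective (trans (sym len′) len)) (map reduce P)
        (All.map⁺ (All.map (λ (o , ns′) → reduce-nonsingular o ns′) (All.zip (orth , nss))))
        (AllPairs-map⁺ (λ _ o o′ → trans (dot-reduce _ _ o) (trans (cong (ℤ._*_ (w e)) o′) (ℤ.*-zeroʳ (w e))))
          orth orths)))
    where
    -- Cross-multiplication avoids division in ℤ, at the price of scaling the products by the
    -- nonzero `w e`.
    eliminate : (I → ℤ) → I → ℤ
    eliminate v i = w e ℤ.* v i ℤ.- v e ℤ.* w i

    reduce : Vectors → Vectors
    reduce (u′ , v) = u′ , eliminate v

    dot-reduce : ∀ x v → dot L x w ≡ 0ℤ → dot L′ x (eliminate v) ≡ w e ℤ.* dot L x v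
    dot-reduce x v xw≡0 = begin
      dot L′ x (eliminate v)                            ≡⟨ pivot-vanishes (x e) (w e) (v e) _ ⟨
      x e ℤ.* eliminate v e ℤ.+ dot L′ x (eliminate v)  ≡⟨ split x (eliminate v) ⟨
      dot L x (eliminate v)                             ≡⟨ dot-combine L x v w (w e) (v e) ⟩
      w e ℤ.* dot L x v ℤ.- v e ℤ.* dot L x w           ≡⟨ cong (λ z → w e ℤ.* dot L x v ℤ.- v e ℤ.* z) xw≡0 ⟩
      w e ℤ.* dot L x v ℤ.- v e ℤ.* 0ℤ                  ≡⟨ drop-zero (w e ℤ.* dot L x v) (v e) ⟩
      w e ℤ.* dot L x v                                 ∎
      where
      open ≡-Reasoning
      pivot-vanishes : ∀ a b c d → a ℤ.* (b ℤ.* c ℤ.- c ℤ.* b) ℤ.+ d ≡ d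
      pivot-vanishes = solve-∀
      drop-zero : ∀ a b → a ℤ.- b ℤ.* 0ℤ ≡ a
      drop-zero = solve-∀

    reduce-nonsingular : ∀ {q} → Orthogonal L (u , w) q → Nonsingular L q → Nonsingular L′ (reduce q)
    reduce-nonsingular {x , v} o ns′ eq =
      [ we≢0 , ns′ ]′ (ℤ.i*j≡0⇒i≡0∨j≡0 (w e) (trans (sym (dot-reduce x v o)) eq))

-- The polynomial of a request

-- The shift by one separates page 0 from an empty slot.
encode : Maybe Page → ℤ
encode nothing  = 0ℤ
encode (just p) = ℤ.+ suc p

encode-injective : ∀ x y → encode x ≡ encode y → x ≡ y
encode-injective nothing  nothing  _    = refl
encode-injective (just _) (just _) refl = refl

value : ∀ {k} → Subset k → ℤ → Config k → ℤ
value []            a C = 1ℤ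
value (outside ∷ S) a C = value S a (C ∘ suc)
value (inside ∷ S)  a C = (a ℤ.- encode (C zero)) ℤ.* value S a (C ∘ suc)

-- For T ⊆ S this is (-1)^|T| times a to the power |S| - |T|, the coefficient of the monomial of T
-- in the product of a - c_s over s in S.
coefficient : ∀ {k} → Subset k → ℤ → Subset k → ℤ
coefficient []            a []            = 1ℤ
coefficient (outside ∷ S) a (outside ∷ T) = coefficient S a T
coefficient (outside ∷ S) a (inside ∷ T)  = 0ℤ
coefficient (inside ∷ S)  a (outside ∷ T) = a ℤ.* coefficient S a T
coefficient (inside ∷ S)  a (inside ∷ T)  = -1ℤ ℤ.* coefficient S a T

monomial : ∀ {k} → Config k → Subset k → ℤ
monomial C []            = 1ℤ
monomial C (outside ∷ T) = monomial (C ∘ suc) T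
monomial C (inside ∷ T)  = encode (C zero) ℤ.* monomial (C ∘ suc) T

dot-map : ∀ {I J : Set} (g : J → I) u w u′ w′ a →
  (∀ j → u (g j) ℤ.* w (g j) ≡ a ℤ.* (u′ j ℤ.* w′ j)) →
  ∀ L → dot (map g L) u w ≡ a ℤ.* dot L u′ w′
dot-map g u w u′ w′ a eq []      = sym (ℤ.*-zeroʳ a)
dot-map g u w u′ w′ a eq (j ∷ L) =
  trans (cong₂ ℤ._+_ (eq j) (dot-map g u w u′ w′ a eq L))
        (sym (ℤ.*-distribˡ-+ a (u′ j ℤ.* w′ j) (dot L u′ w′)))

-- Induction on the slots: the subsets split by whether they contain the first one, and each half is
-- a multiple of the expansion over the remaining slots.
value-expand : ∀ {k} (S : Subset k) a C →
  dot (allSubsets k) (coefficient S a) (monomial C) ≡ value S a C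
value-expand []                    a C = refl
value-expand {suc k} (outside ∷ S) a C = begin
  dot (allSubsets (suc k)) u w                 ≡⟨ dot-++ (map (outside ∷_) L) (map (inside ∷_) L) u w ⟩
  dot (map (outside ∷_) L) u w
    ℤ.+ dot (map (inside ∷_) L) u w            ≡⟨ cong₂ ℤ._+_
                                                    (dot-map (outside ∷_) u w u′ w′ 1ℤ (λ T → sym (ℤ.*-identityˡ (u′ T ℤ.* w′ T))) L)
                                                    (dot-map (inside ∷_) u w u′ w′ 0ℤ (λ _ → refl) L) ⟩
  1ℤ ℤ.* dot L u′ w′ ℤ.+ 0ℤ ℤ.* dot L u′ w′    ≡⟨ simplify (dot L u′ w′) ⟩
  dot L u′ w′                                  ≡⟨ value-expand S a (C ∘ suc) ⟩
  value S a (C ∘ suc)                          ∎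
  where
  open ≡-Reasoning
  L  = allSubsets k
  u  = coefficient (outside ∷ S) a
  w  = monomial C
  u′ = coefficient S a
  w′ = monomial (C ∘ suc)
  simplify : ∀ x → 1ℤ ℤ.* x ℤ.+ 0ℤ ℤ.* x ≡ x
  simplify = solve-∀
value-expand {suc k} (inside ∷ S)  a C = begin
  dot (allSubsets (suc k)) u w                        ≡⟨ dot-++ (map (outside ∷_) L) (map (inside ∷_) L) u w ⟩
  dot (map (outside ∷_) L) u w
    ℤ.+ dot (map (inside ∷_) L) u w                   ≡⟨ cong₂ ℤ._+_
                                                           (dot-map (outside ∷_) u w u′ w′ a (λ T → ℤ.*-assoc a (u′ T) (w′ T)) L)
                                                           (dot-map (inside ∷_) u w u′ w′ (ℤ.- c) (λ T → interchange c (u′ T) (w′ T)) L) ⟩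
  a ℤ.* dot L u′ w′ ℤ.+ (ℤ.- c) ℤ.* dot L u′ w′       ≡⟨ ℤ.*-distribʳ-+ (dot L u′ w′) a (ℤ.- c) ⟨
  (a ℤ.- c) ℤ.* dot L u′ w′                           ≡⟨ cong (ℤ._*_ (a ℤ.- c)) (value-expand S a (C ∘ suc)) ⟩
  (a ℤ.- c) ℤ.* value S a (C ∘ suc)                   ∎
  where
  open ≡-Reasoning
  L  = allSubsets k
  c  = encode (C zero)
  u  = coefficient (inside ∷ S) a
  w  = monomial C
  u′ = coefficient S a
  w′ = monomial (C ∘ suc)
  interchange : ∀ c x y → (-1ℤ ℤ.* x) ℤ.* (c ℤ.* y) ≡ (ℤ.- c) ℤ.* (x ℤ.* y)
  interchange = solve-∀

coefficient-support : ∀ {k} (S : Subset k) a T → ¬ T Sub.⊆ S → coefficient S a T ≡ 0ℤ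
coefficient-support []            a []            T⊈S = contradiction (λ ()) T⊈S
coefficient-support (outside ∷ S) a (outside ∷ T) T⊈S = coefficient-support S a T (λ T⊆S → T⊈S (out⊆ T⊆S))
coefficient-support (outside ∷ S) a (inside ∷ T)  T⊈S = refl
coefficient-support (inside ∷ S)  a (outside ∷ T) T⊈S =
  trans (cong (ℤ._*_ a) (coefficient-support S a T (λ T⊆S → T⊈S (out⊆ T⊆S)))) (ℤ.*-zeroʳ a)
coefficient-support (inside ∷ S)  a (inside ∷ T)  T⊈S =
  cong (ℤ._*_ -1ℤ) (coefficient-support S a T (λ T⊆S → T⊈S (in⊆in T⊆S)))

satisfies⇒value≡0 : ∀ {k} (C : Config k) p S → Satisfies C (p , S) → value S (encode (just p)) C ≡ 0ℤ
satisfies⇒value≡0 C p (inside ∷ S)  (zero , here , eq)      rewrite eq =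
  cong (λ x → x ℤ.* value S (encode (just p)) (C ∘ suc)) (ℤ.+-inverseʳ (encode (just p)))
satisfies⇒value≡0 C p (inside ∷ S)  (suc s , there s∈S , eq) =
  trans (cong (ℤ._*_ (encode (just p) ℤ.- encode (C zero))) (satisfies⇒value≡0 (C ∘ suc) p S (s , s∈S , eq)))
        (ℤ.*-zeroʳ (encode (just p) ℤ.- encode (C zero)))
satisfies⇒value≡0 C p (outside ∷ S) (suc s , there s∈S , eq) = satisfies⇒value≡0 (C ∘ suc) p S (s , s∈S , eq)

-- As ℤ has no zero divisors, some factor vanishes, and injectivity of `encode` turns it into a slot
-- holding p.
value≡0⇒satisfies : ∀ {k} (C : Config k) p S → value S (encode (just p)) C ≡ 0ℤ → Satisfies C (p , S)
value≡0⇒satisfies C p []            ()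
value≡0⇒satisfies C p (outside ∷ S) eq =
  let s , s∈S , Cs≡p = value≡0⇒satisfies (C ∘ suc) p S eq in suc s , there s∈S , Cs≡p
value≡0⇒satisfies C p (inside ∷ S)  eq with ℤ.i*j≡0⇒i≡0∨j≡0 (encode (just p) ℤ.- encode (C zero)) eq
... | inj₁ eq₀ = zero , here , sym (encode-injective (just p) (C zero) (ℤ.i-j≡0⇒i≡j (encode (just p)) (encode (C zero)) eq₀))
... | inj₂ eq₁ =
  let s , s∈S , Cs≡p = value≡0⇒satisfies (C ∘ suc) p S eq₁ in suc s , there s∈S , Cs≡p

-- Bounds on the number of costly steps of a phase

Step : ℕ → Set
Step k = Request k × Config k

Costly : ∀ {k} → List (Subset k) → Step k → Set
Costly F (r , C) = proj₂ r ∈ F × ¬ Satisfies C r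

-- Steps are listed most recent first, so in `AllPairs Respects` each configuration satisfies the
-- requests of all older steps.
Respects : ∀ {k} → Step k → Step k → Set
Respects (_ , C) (r , _) = Satisfies C r

-- Violated requests give the nonzero diagonal and respected ones the zeros of a triangular system.
-- Coefficients outside F* vanish, so its dimension is `starSize F`.
length≤starSize : ∀ {k} (F : List (Subset k)) P →
  All (Costly F) P → AllPairs Respects P → length P ≤ starSize F
length≤starSize {k} F P costly respects =
  subst (_≤ starSize F) (length-map vectors P)
    (triangular-length (starSize F) F* refl (map vectors P)
      (All.map⁺ (All.map (λ { {(p , S) , C} (S∈F , ¬sat) eq →
        ¬sat (value≡0⇒satisfies C p S (trans (sym (expand S∈F C)) eq)) }) costly))
      (AllPairs-map⁺ (λ { {_ , C} {(p , S) , _} _ (S∈F , _) sat →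
        trans (expand S∈F C) (satisfies⇒value≡0 C p S sat) }) costly respects))
  where
  below? = λ T → any? (λ S → T ⊆? S) F
  F* = filter below? (allSubsets k)

  vectors : Step k → Vectors
  vectors ((p , S) , C) = coefficient S (encode (just p)) , monomial C

  expand : ∀ {S a} → S ∈ F → ∀ C → dot F* (coefficient S a) (monomial C) ≡ value S a C
  expand {S} {a} S∈F C =
    trans (dot-filter below? _ _ (λ T ∉F* → coefficient-support S a T (λ T⊆S → ∉F* (lose S∈F T⊆S))) (allSubsets k))
          (value-expand S a C)

-- Incidences of slots and sets, and the mass bound

elements : ∀ {k} → Subset k → List (Fin k)
elements []            = []
elements (outside ∷ S) = map suc (elements S)
elements (inside ∷ S)  = zero ∷ map suc (elements S)

length-elements : ∀ {k} (S : Subset k) → length (elements S) ≡ ∣ S ∣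
length-elements []            = refl
length-elements (outside ∷ S) = trans (length-map suc (elements S)) (length-elements S)
length-elements (inside ∷ S)  = cong suc (trans (length-map suc (elements S)) (length-elements S))

∈-elements : ∀ {k s} {S : Subset k} → s Sub.∈ S → s ∈ elements S
∈-elements here                            = here refl
∈-elements {S = outside ∷ _} (there s∈S) = ∈-map⁺ suc (∈-elements s∈S)
∈-elements {S = inside ∷ _}  (there s∈S) = there (∈-map⁺ suc (∈-elements s∈S))

incidences : ∀ {k} → List (Subset k) → List (Subset k × Fin k)
incidences []      = []
incidences (S ∷ F) = map (S ,_) (elements S) ++ incidences F

length-incidences : ∀ {k} (F : List (Subset k)) → length (incidences F) ≡ mass F
length-incidences []      = refl
length-incidences (S ∷ F) = trans (length-++ (map (S ,_) (elements S)))
  (cong₂ _+_ (trans (length-map (S ,_) (elements S)) (length-elements S)) (length-incidences F))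

∈-incidences : ∀ {k F s} {S : Subset k} → S ∈ F → s Sub.∈ S → (S , s) ∈ incidences F
∈-incidences {S = S}      (here refl) s∈S = ∈-++⁺ˡ (∈-map⁺ (S ,_) (∈-elements s∈S))
∈-incidences {F = S′ ∷ _} (there S∈F) s∈S = ∈-++⁺ʳ (map (S′ ,_) (elements S′)) (∈-incidences S∈F s∈S)

lookup-injective : ∀ {A : Set} {xs : List A} → Unique xs → ∀ {i j} → lookup xs i ≡ lookup xs j → i ≡ j
lookup-injective (_ ∷ _)  {zero}  {zero}  _  = refl
lookup-injective (x∉ ∷ _) {zero}  {suc j} eq = contradiction eq (All.lookup x∉ (∈-lookup j))
lookup-injective (x∉ ∷ _) {suc i} {zero}  eq = contradiction (sym eq) (All.lookup x∉ (∈-lookup i))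
lookup-injective (_ ∷ u)  {suc i} {suc j} eq = cong suc (lookup-injective u eq)

-- Each request goes to its set paired with a slot of it where `C` holds the page. The pair
-- determines the request, since the page can be read off from `C`.
length≤mass : ∀ {k} (F : List (Subset k)) (C : Config k) rs → Unique rs →
  All (λ r → proj₂ r ∈ F) rs → SatisfiesAll C rs → length rs ≤ mass F
length≤mass {k} F C rs unique S∈F sat =
  subst (length rs ≤_) (length-incidences F) (injective⇒≤ {f = index ∘ incident} injective)
  where
  slot : ∀ i → Satisfies C (lookup rs i)
  slot i = All.lookup sat (∈-lookup i)

  incident : ∀ i → (proj₂ (lookup rs i) , proj₁ (slot i)) ∈ incidences F
  incident i = ∈-incidences (All.lookup S∈F (∈-lookup i)) (proj₁ (proj₂ (slot i)))

  injective : ∀ {i j} → index (incident i) ≡ index (incident j) → i ≡ j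
  injective {i} {j} eq = lookup-injective unique (cong₂ _,_ same-page (cong proj₁ same-pair))
    where
    same-pair = Membership.index-injective (setoid _) (incident i) (incident j) eq
    same-page = just-injective (trans (sym (proj₂ (proj₂ (slot i))))
      (trans (cong C (cong proj₂ same-pair)) (proj₂ (proj₂ (slot j)))))

-- Retrievals

module _ {A : Set} (f : A → ℕ) where

  sum-map≤length : (∀ x → f x ≤ 1) → ∀ xs → sum (map f xs) ≤ length xs
  sum-map≤length f≤1 []       = z≤n
  sum-map≤length f≤1 (x ∷ xs) = ℕ.+-mono-≤ (f≤1 x) (sum-map≤length f≤1 xs)

  sum-map≡0⁺ : (∀ x → f x ≡ 0) → ∀ xs → sum (map f xs) ≡ 0
  sum-map≡0⁺ f≡0 []       = refl
  sum-map≡0⁺ f≡0 (x ∷ xs) = cong₂ _+_ (f≡0 x) (sum-map≡0⁺ f≡0 xs)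

  sum-map≡0⁻ : ∀ {x xs} → sum (map f xs) ≡ 0 → x ∈ xs → f x ≡ 0
  sum-map≡0⁻ {xs = x ∷ _} eq (here refl)  = ℕ.m+n≡0⇒m≡0 (f x) eq
  sum-map≡0⁻ {xs = y ∷ _} eq (there x∈xs) = sum-map≡0⁻ (ℕ.m+n≡0⇒n≡0 (f y) eq) x∈xs

retrievedIn≤1 : ∀ x y → retrievedIn x y ≤ 1
retrievedIn≤1 x        nothing  = z≤n
retrievedIn≤1 nothing  (just p) = s≤s z≤n
retrievedIn≤1 (just q) (just p) with q ≡ᵇ p
... | true  = z≤n
... | false = s≤s z≤n

retrievedIn-refl : ∀ x → retrievedIn x x ≡ 0
retrievedIn-refl nothing  = refl
retrievedIn-refl (just p) with p ≡ᵇ p | ≡⇒≡ᵇ p p refl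
... | true | _ = refl

retrievedIn≡0 : ∀ x p → retrievedIn x (just p) ≡ 0 → x ≡ just p
retrievedIn≡0 (just q) p eq with q ≡ᵇ p | ≡ᵇ⇒≡ q p
... | true | q≡p = cong just (q≡p _)

retrievals≤k : ∀ {k} (C D : Config k) → retrievals C D ≤ k
retrievals≤k {k} C D = subst (retrievals C D ≤_) (length-tabulate {n = k} _)
  (sum-map≤length _ (λ s → retrievedIn≤1 (C s) (D s)) (allFin k))

retrievals-refl : ∀ {k} (C : Config k) → retrievals C C ≡ 0
retrievals-refl {k} C = sum-map≡0⁺ _ (λ s → retrievedIn-refl (C s)) (allFin k)

infix 4 _⊑_
_⊑_ : ∀ {k} → Config k → Config k → Set
D ⊑ E = ∀ {s p} → D s ≡ just p → E s ≡ just p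

-- Evictions are free, so a step without cost can still lose pages; hence an inclusion and not an
-- equality.
retrievals≡0⇒⊑ : ∀ {k} (D D′ : Config k) → retrievals D D′ ≡ 0 → D′ ⊑ D
retrievals≡0⇒⊑ D D′ eq {s} {p} D′s≡p =
  retrievedIn≡0 (D s) p (subst (λ x → retrievedIn (D s) x ≡ 0) D′s≡p (sum-map≡0⁻ _ eq (∈-allFin s)))

satisfies-⊑ : ∀ {k r} {D E : Config k} → D ⊑ E → Satisfies D r → Satisfies E r
satisfies-⊑ D⊑E (s , s∈S , Ds≡p) = s , s∈S , D⊑E Ds≡p

-- The amortised analysis

-- Either the solution, now in configuration d, has already paid for the current
-- phase (credit x), or it has retrieved nothing since the phase began.
data Credit {k} (w : List (Request k)) (d : Config k) : ℕ → Set where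
  paid   : Credit w d 1
  unpaid : ∀ {E} → d ⊑ E → SatisfiesAll E w → Credit w d 0

-- A retrieval pays for the phase at once. Without one the configuration only shrinks, so `E` still
-- contains it and inherits the new request.
credit-step : ∀ {k w x} {d d′ : Config k} {r} → Credit w d x → Satisfies d′ r →
  ∃ λ x′ → Credit (w ++ [ r ]) d′ x′ × x′ ≤ retrievals d d′ + x
credit-step {d = d} {d′} paid sat = 1 , paid , ℕ.m≤n+m 1 (retrievals d d′)
credit-step {d = d} {d′} (unpaid {E} d⊑E sats) sat with retrievals d d′ in eq
... | suc n = 1 , paid , s≤s z≤n
... | zero  = 0 , unpaid d′⊑E (All.++⁺ sats (satisfies-⊑ d′⊑E sat ∷ [])) , z≤n
  where
  d′⊑E : d′ ⊑ E
  d′⊑E e = d⊑E (retrievals≡0⇒⊑ d d′ eq e)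

-- Used at a restart: an unpaid phase would provide an `E` satisfying the unsatisfiable window.
credit-unsatisfiable : ∀ {k w x} {d : Config k} → Credit w d x →
  ¬ (∃ λ E → SatisfiesAll E w) → x ≡ 1
credit-unsatisfiable paid             _     = refl
credit-unsatisfiable (unpaid _ sats) unsat = ⊥-elim (unsat (_ , sats))

-- The costly steps of the current phase, most recent first.
record Phase {k} (F : List (Subset k)) (w : List (Request k)) (C : Config k) (P : List (Step k)) : Set where
  field
    costly    : All (Costly F) P
    respects  : AllPairs Respects P
    in-window : All (λ q → proj₁ q ∈ w) P
    satisfied : All (λ q → Satisfies C (proj₁ q)) P

bound : ∀ {k} → List (Subset k) → ℕ
bound F = starSize F ⊓ mass F

module _ {k} {F : List (Subset k)} where

  open Phase

  phase-length : ∀ {w C P} → Phase F w C P → length P ≤ bound F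
  phase-length {C = C} {P} ph = ℕ.⊓-glb
    (length≤starSize F P (costly ph) (respects ph))
    (subst (_≤ mass F) (length-map proj₁ P)
      (length≤mass F C (map proj₁ P)
        -- A repeated request would be both violated and satisfied by the configuration before its
        -- later occurrence.
        (AllPairs-map⁺ (λ { (_ , ¬sat) _ sat refl → ¬sat sat }) (costly ph) (respects ph))
        (All.map⁺ (All.map proj₁ (costly ph)))
        (All.map⁺ (satisfied ph))))

  phase-keep : ∀ {w C P r} → Phase F w C P → Phase F (w ++ [ r ]) C P
  phase-keep ph = record
    { costly    = costly ph
    ; respects  = respects ph
    ; in-window = All.map ∈-++⁺ˡ (in-window ph)
    ; satisfied = satisfied ph
    }

  -- The new configuration is only known to satisfy the window; `in-window` carries this over to the
  -- older costly requests.
  phase-extend : ∀ {w C C′ P r} → Phase F w C P → proj₂ r ∈ F → ¬ Satisfies C r →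
    SatisfiesAll C′ (w ++ [ r ]) → Phase F (w ++ [ r ]) C′ ((r , C) ∷ P)
  phase-extend {w} {C} {C′} {P} {r} ph r∈F ¬sat sats = record
    { costly    = (r∈F , ¬sat) ∷ costly ph
    ; respects  = satisfied ph ∷ respects ph
    ; in-window = in-window′
    ; satisfied = All.map (All.lookup sats) in-window′
    }
    where
    in-window′ : All (λ q → proj₁ q ∈ w ++ [ r ]) ((r , C) ∷ P)
    in-window′ = ∈-++⁺ʳ w (here refl) ∷ All.map ∈-++⁺ˡ (in-window ph)

  phase-empty : ∀ {w C} → Phase F w C []
  phase-empty = record { costly = [] ; respects = [] ; in-window = [] ; satisfied = [] }

  -- On the left, `k * length P` is the charge for the costly steps already made in the current
  -- phase; on the right, `x` is the credit for it, and the last term covers the phase left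
  -- unfinished at the end.
  amortised : ∀ {w C P d x rs Cs Ds} → Phase F w C P → Credit w d x →
    All (λ r → proj₂ r ∈ F) rs → ExhRun w C rs Cs → IsSolution rs Ds →
    costFrom C Cs + k * length P ≤ (k * bound F) * (costFrom d Ds + x) + k * bound F
  amortised ph cr [] [] [] =
    ℕ.≤-trans (ℕ.*-monoʳ-≤ k (phase-length ph)) (ℕ.m≤n+m (k * bound F) _)
  amortised {C = C} {P} {d} {x} ph cr (r∈F ∷ rs∈F) (_∷_ {C' = C′} {Cs = Cs} step run) (_∷_ {C = d′} {Cs = Ds} sat sol)
    with credit-step {d = d} cr sat
  ... | x′ , cr′ , x′≤ = by-cases step run
    where
    open ℕ.≤-Reasoning
    kM = k * bound F

    pay : kM * (costFrom d′ Ds + x′) + kM ≤ kM * (retrievals d d′ + costFrom d′ Ds + x) + kM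
    pay = ℕ.+-monoˡ-≤ kM (ℕ.*-monoʳ-≤ kM (begin
      costFrom d′ Ds + x′                       ≤⟨ ℕ.+-monoʳ-≤ (costFrom d′ Ds) x′≤ ⟩
      costFrom d′ Ds + (retrievals d d′ + x)    ≡⟨ rotate (costFrom d′ Ds) (retrievals d d′) x ⟩
      retrievals d d′ + costFrom d′ Ds + x      ∎))
      where
      rotate : ∀ a b c → a + (b + c) ≡ b + a + c
      rotate = ℕ-Solver.solve-∀

    by-cases : ∀ {w′} → ExhStep _ C _ w′ C′ → ExhRun w′ C′ _ Cs →
      retrievals C C′ + costFrom C′ Cs + k * length P
        ≤ kM * (retrievals d d′ + costFrom d′ Ds + x) + kM
    by-cases (keep _) run = begin
      retrievals C C + costFrom C Cs + k * length P  ≡⟨ cong (λ z → z + costFrom C Cs + k * length P) (retrievals-refl C) ⟩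
      costFrom C Cs + k * length P                   ≤⟨ amortised (phase-keep ph) cr′ rs∈F run sol ⟩
      kM * (costFrom d′ Ds + x′) + kM                ≤⟨ pay ⟩
      _                                              ∎
    by-cases (extend ¬sat sats) run = begin
      retrievals C C′ + costFrom C′ Cs + k * length P  ≤⟨ ℕ.+-monoˡ-≤ (k * length P) (ℕ.+-monoˡ-≤ (costFrom C′ Cs) (retrievals≤k C C′)) ⟩
      k + costFrom C′ Cs + k * length P                ≡⟨ regroup k (costFrom C′ Cs) (length P) ⟩
      costFrom C′ Cs + k * suc (length P)              ≤⟨ amortised (phase-extend ph r∈F ¬sat sats) cr′ rs∈F run sol ⟩
      kM * (costFrom d′ Ds + x′) + kM                  ≤⟨ pay ⟩
      _                                                ∎
      where
      regroup : ∀ k c n → k + c + k * n ≡ c + k * (1 + n)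
      regroup = ℕ-Solver.solve-∀
    -- The credit 1 of the closed phase pays its total charge of at most `kM`. The new phase opens
    -- with one costly step and credit 0, with the solution's current `d′` as its `E`.
    by-cases (restart ¬sat unsat satC′) run = begin
      retrievals C C′ + costFrom C′ Cs + k * length P  ≤⟨ ℕ.+-mono-≤ (ℕ.+-monoˡ-≤ (costFrom C′ Cs) (retrievals≤k C C′)) (ℕ.*-monoʳ-≤ k (phase-length ph)) ⟩
      k + costFrom C′ Cs + kM                          ≡⟨ regroup k (costFrom C′ Cs) kM ⟩
      costFrom C′ Cs + k * 1 + kM                      ≤⟨ ℕ.+-monoˡ-≤ kM (amortised
                                                            (phase-extend {w = []} phase-empty r∈F ¬sat (satC′ ∷ []))
                                                            (unpaid (λ e → e) (sat ∷ [])) rs∈F run sol) ⟩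
      kM * (costFrom d′ Ds + 0) + kM + kM              ≡⟨ use-credit kM (costFrom d′ Ds) ⟩
      kM * (costFrom d′ Ds + 1) + kM                   ≡⟨ cong (λ z → kM * (costFrom d′ Ds + z) + kM) (credit-unsatisfiable cr′ unsat) ⟨
      kM * (costFrom d′ Ds + x′) + kM                  ≤⟨ pay ⟩
      _                                                ∎
      where
      regroup : ∀ k c m → k + c + m ≡ c + k * 1 + m
      regroup = ℕ-Solver.solve-∀
      use-credit : ∀ m c → m * (c + 0) + m + m ≡ m * (c + 1) + m
      use-credit = ℕ-Solver.solve-∀

-- The competitive ratio

cost≤k+costFrom : ∀ {k} (C : Config k) Cs → cost Cs ≤ k + costFrom C Cs
cost≤k+costFrom C []        = z≤n
cost≤k+costFrom C (C′ ∷ Cs) =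
  ℕ.+-mono-≤ (retrievals≤k emptyConfig C′) (ℕ.m≤n+m (costFrom C′ Cs) (retrievals C C′))

theorem1 : (k : ℕ) → 1 ≤ k → (F : List (Subset k)) → Unique F → All Nonempty F →
    ∃ λ (b : ℕ) → (σ : List (Request k)) → All (λ r → proj₂ r ∈ F) σ →
    (C₀ : Config k) (Cs : List (Config k)) → ExhSearchRun C₀ σ Cs →
    (D : List (Config k)) → IsSolution σ D →
    cost Cs ≤ (k * (starSize F ⊓ mass F)) * cost D + b
-- The constant is `k` for counting the first retrievals from the empty configuration instead of
-- `C₀`, plus `kM` for the last phase.
theorem1 k _ F _ _ = k + kM , λ σ σ∈F C₀ Cs run D sol → begin
  cost Cs                         ≤⟨ cost≤k+costFrom C₀ Cs ⟩
  k + costFrom C₀ Cs              ≤⟨ ℕ.+-monoʳ-≤ k (ℕ.m≤m+n (costFrom C₀ Cs) (k * 0)) ⟩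
  k + (costFrom C₀ Cs + k * 0)    ≤⟨ ℕ.+-monoʳ-≤ k (amortised phase-empty
                                       (unpaid {E = emptyConfig} (λ e → e) []) σ∈F run sol) ⟩
  k + (kM * (cost D + 0) + kM)    ≡⟨ regroup k kM (cost D) ⟩
  kM * cost D + (k + kM)          ∎
  where
  open ℕ.≤-Reasoning
  kM = k * bound F
  regroup : ∀ k m c → k + (m * (c + 0) + m) ≡ m * c + (k + m)
  regroup = ℕ-Solver.solve-∀
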